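{- Let $k\ge 2$. A bipartite graph $G$ is a $k$-critical ACB graph if and only if $G$ is isomorphic to $B_k$.
   Context: For a bipartite graph $B=(X,Y,E)$ with color classes $X,Y$: the mirror $mir(B)$ has the same color classes and $xy$ ($x\in X$, $y\in Y$) is an edge iff it is not an edge of $B$; $B$ is chordal bipartite if it has no induced chordless cycle $C_{2m}$, $m\ge3$; $B$ is ACB if both $B$ and $mir(B)$ are chordal bipartite. $\nabla_B(X)$ is the maximum number of vertices of $X$ whose neighborhoods are pairwise incomparable under set inclusion (equal neighborhoods count as comparable), $\nabla_B(Y)$ analogously, and the bipartite Dilworth number is $bip\text{ - }dilw(B)=\max(\nabla_B(X),\nabla_B(Y))$. An ACB graph $G$ is $k$-critical if $bip\text{ - }dilw(G)=k$ and $bip\text{ - }dilw(G-v)\le k-1$ for every vertex $v$ (where $G-v$ is the bipartite graph obtained by deleting $v$). $B_k$ is the bipartite graph with color classes $\{x_1,\dots,x_k\}$ and $\{y_1,\dots,y_{2k-2}\}$ in which $N(x_i)=\{y_i,\dots,y_{i+k-2}\}$ for $i=1,\dots,k$. -}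

module Defs where

open import Data.Nat using (ℕ; zero; suc; _+_; _∸_; _*_; _≤_; _⊔_; _≤ᵇ_; _%_)
open import Data.Fin using (Fin; toℕ; punchIn)
open import Data.Bool using (Bool; true; false; not; _∧_)
open import Data.Product using (Σ; ∃; _×_; _,_)
open import Data.Sum using (_⊎_)
open import Relation.Binary.PropositionalEquality using (_≡_; _≢_)
open import Relation.Nullary using (¬_)
open import Function.Bundles using (_↔_; Inverse)
open import Function.Definitions using (Injective)

record BGraph : Set where
  constructor bgraph
  field
    m : ℕ
    n : ℕ
    E : Fin m → Fin n → Bool

open BGraph public

Adj : (G : BGraph) → Fin (m G) → Fin (n G) → Set
Adj G x y = E G x y ≡ true

mir : BGraph → BGraph
mir G = bgraph (m G) (n G) (λ x y → not (E G x y))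

-- Adjacency pattern of the cycle C_{2L} on x_0 y_0 x_1 y_1 ... x_{L-1} y_{L-1}:
-- x_i is adjacent to y_j iff j = i or j = i+1 (mod L).  Here L = 3 + l.
CycAdj : (l : ℕ) → Fin (3 + l) → Fin (3 + l) → Set
CycAdj l i j = (toℕ j ≡ toℕ i) ⊎ (toℕ j ≡ suc (toℕ i) % (3 + l))

HasInducedCycle : BGraph → ℕ → Set
HasInducedCycle G l =
  Σ (Fin (3 + l) → Fin (m G)) λ xs →
  Σ (Fin (3 + l) → Fin (n G)) λ ys →
    Injective _≡_ _≡_ xs × Injective _≡_ _≡_ ys ×
    (∀ i j → (Adj G (xs i) (ys j) → CycAdj l i j) × (CycAdj l i j → Adj G (xs i) (ys j)))

ChordalBipartite : BGraph → Set
ChordalBipartite G = ∀ l → ¬ HasInducedCycle G l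

ACB : BGraph → Set
ACB G = ChordalBipartite G × ChordalBipartite (mir G)

NX⊆ : (G : BGraph) → Fin (m G) → Fin (m G) → Set
NX⊆ G x x' = ∀ y → Adj G x y → Adj G x' y

NY⊆ : (G : BGraph) → Fin (n G) → Fin (n G) → Set
NY⊆ G y y' = ∀ x → Adj G x y → Adj G x y'

-- r vertices of X with pairwise incomparable neighbourhoods
-- (equal neighbourhoods count as comparable)
AntichainX : BGraph → ℕ → Set
AntichainX G r = Σ (Fin r → Fin (m G)) λ f →
  Injective _≡_ _≡_ f × (∀ i j → i ≢ j → ¬ NX⊆ G (f i) (f j))

AntichainY : BGraph → ℕ → Set
AntichainY G r = Σ (Fin r → Fin (n G)) λ f →
  Injective _≡_ _≡_ f × (∀ i j → i ≢ j → ¬ NY⊆ G (f i) (f j))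

NablaX : BGraph → ℕ → Set
NablaX G r = AntichainX G r × (∀ s → AntichainX G s → s ≤ r)

NablaY : BGraph → ℕ → Set
NablaY G r = AntichainY G r × (∀ s → AntichainY G s → s ≤ r)

BipDilw : BGraph → ℕ → Set
BipDilw G d = Σ ℕ λ a → Σ ℕ λ b → NablaX G a × NablaY G b × d ≡ a ⊔ b

delX' : ∀ {m n} → (Fin m → Fin n → Bool) → Fin m → BGraph
delX' {suc m} {n} e i = bgraph m n (λ a b → e (punchIn i a) b)

delY' : ∀ {m n} → (Fin m → Fin n → Bool) → Fin n → BGraph
delY' {m} {suc n} e j = bgraph m n (λ a b → e a (punchIn j b))

delX : (G : BGraph) → Fin (m G) → BGraph
delX G = delX' (E G)

delY : (G : BGraph) → Fin (n G) → BGraph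
delY G = delY' (E G)

KCriticalACB : ℕ → BGraph → Set
KCriticalACB k G =
  ACB G × BipDilw G k ×
  (∀ x → Σ ℕ λ d → BipDilw (delX G x) d × d ≤ k ∸ 1) ×
  (∀ y → Σ ℕ λ d → BipDilw (delY G y) d × d ≤ k ∸ 1)

Bk : ℕ → BGraph
Bk k = bgraph k (2 * k ∸ 2)
  (λ i j → (toℕ i ≤ᵇ toℕ j) ∧ (toℕ j ≤ᵇ toℕ i + (k ∸ 2)))

-- isomorphism of bipartite graphs (as graphs: may preserve or swap the color classes)
IsoSame : BGraph → BGraph → Set
IsoSame G H = Σ (Fin (m G) ↔ Fin (m H)) λ φ → Σ (Fin (n G) ↔ Fin (n H)) λ ψ →
  ∀ x y → E G x y ≡ E H (Inverse.to φ x) (Inverse.to ψ y)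

IsoSwap : BGraph → BGraph → Set
IsoSwap G H = Σ (Fin (m G) ↔ Fin (n H)) λ φ → Σ (Fin (n G) ↔ Fin (m H)) λ ψ →
  ∀ x y → E G x y ≡ E H (Inverse.to ψ y) (Inverse.to φ x)

_≅_ : BGraph → BGraph → Set
G ≅ H = IsoSame G H ⊎ IsoSwap G H

module Submission where

-- Call b between a and c when no vertex of Y separates b from both a and c, i.e. every y agrees
-- on b with a or with c.  In an ACB graph, forbidding C₆ and its mirror gives every three
-- vertices with pairwise incomparable neighbourhoods exactly one middle vertex, and forbidding
-- C₈ makes this betweenness the one of a linear order.  In a linearly ordered antichain
-- x₁ < … < xₖ a vertex of Y separating xᵢ from xᵢ₊₁ sees exactly x₁, …, xᵢ or exactly
-- xᵢ₊₁, …, xₖ; choosing both kinds for every i yields an induced Bₖ, which by criticality is the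
-- whole graph.  Conversely, a graph whose X-side is linearly ordered in this way contains no
-- induced cycle of length at least 6, and neither does its mirror.

open import Defs
open import Data.Nat using (ℕ; zero; suc; _+_; _∸_; _*_; _≤_; _<_; _⊔_; _%_; z≤n; s≤s)
open import Data.Nat.DivMod using (m<n⇒m%n≡m; n%n≡0)
import Data.Nat.Properties as ℕ
open import Data.Fin using (Fin; suc; toℕ; fromℕ<; opposite; punchIn; punchOut)
open import Data.Fin.Patterns using (0F; 1F; 2F; 3F)
import Data.Fin.Permutation as Perm
import Data.Fin.Properties as Fin
open import Data.Bool using (Bool; true; false; not; _≟_)
open import Data.Bool.Properties using (¬-not; not-¬; not-involutive; T-≡; T-∧)
open import Data.Product as Prod using (Σ; ∃; ∃₂; _×_; _,_; proj₁; proj₂)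
open import Data.Sum as Sum using (_⊎_; inj₁; inj₂; [_,_]′)
open import Data.Vec.Functional using (Vector; _∷_; []; head; tail)
open import Function using (_∘_; id)
open import Function.Bundles using (_⇔_; mk⇔; Equivalence; mk↔ₛ′; Inverse)
open import Function.Definitions using (Injective)
open import Relation.Nullary using (¬_; Dec; yes; no; does; contradiction)
open import Relation.Nullary.Decidable
  using (_×-dec_; _⊎-dec_; _→-dec_; ¬?; from-yes; dec-true; dec-false; map′)
open import Relation.Binary.Definitions using (tri<; tri≈; tri>)
open import Relation.Binary.PropositionalEquality

-- Interchanging the colour classes

transpose : BGraph → BGraph
transpose G = bgraph (n G) (m G) (λ y x → E G x y)

-- Seen from the other colour class, the neighbours of index `j` are `j` and `j - 1` instead of `j`
-- and `j + 1`; reversing both index sets restores the orientation. The case `1+i≡L` is the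
-- wrap-around, where `j` is 0.
CycAdj-opposite : ∀ l i j → CycAdj l i j → CycAdj l (opposite j) (opposite i)
CycAdj-opposite l i j (inj₁ j≡i) =
  inj₁ (cong (toℕ ∘ opposite) (Fin.toℕ-injective (sym j≡i)))
CycAdj-opposite l i j (inj₂ j≡1+i) with ℕ.m≤n⇒m<n∨m≡n (Fin.toℕ<n i)
... | inj₁ 1+i<L = inj₂ (begin
  toℕ (opposite i)               ≡⟨ Fin.opposite-prop i ⟩
  2 + l ∸ toℕ i                  ≡⟨ lem ⟩
  suc (2 + l ∸ toℕ j)            ≡⟨ m<n⇒m%n≡m (s≤s (subst (_≤ 2 + l) lem (ℕ.m∸n≤m (2 + l) (toℕ i)))) ⟨
  suc (2 + l ∸ toℕ j) % (3 + l)  ≡⟨ cong (λ t → suc t % (3 + l)) (Fin.opposite-prop j) ⟨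
  suc (toℕ (opposite j)) % (3 + l) ∎)
  where
  open ≡-Reasoning
  lem : 2 + l ∸ toℕ i ≡ suc (2 + l ∸ toℕ j)
  lem rewrite j≡1+i | m<n⇒m%n≡m 1+i<L = ℕ.+-∸-assoc 1 (ℕ.≤-pred (ℕ.≤-pred 1+i<L))
... | inj₂ 1+i≡L = inj₂ (begin
  toℕ (opposite i)               ≡⟨ Fin.opposite-prop i ⟩
  2 + l ∸ toℕ i                  ≡⟨ cong (3 + l ∸_) 1+i≡L ⟩
  l ∸ l                          ≡⟨ ℕ.n∸n≡0 l ⟩
  0                              ≡⟨ n%n≡0 (3 + l) ⟨
  (3 + l) % (3 + l)              ≡⟨ cong (λ t → suc (2 + l ∸ t) % (3 + l)) j≡0 ⟨
  suc (2 + l ∸ toℕ j) % (3 + l)  ≡⟨ cong (λ t → suc t % (3 + l)) (Fin.opposite-prop j) ⟨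
  suc (toℕ (opposite j)) % (3 + l) ∎)
  where
  open ≡-Reasoning
  j≡0 : toℕ j ≡ 0
  j≡0 = trans j≡1+i (trans (cong (_% (3 + l)) 1+i≡L) (n%n≡0 (3 + l)))

CycAdj-opposite⁻¹ : ∀ l i j → CycAdj l (opposite j) (opposite i) → CycAdj l i j
CycAdj-opposite⁻¹ l i j c =
  subst₂ (CycAdj l) (Fin.opposite-involutive i) (Fin.opposite-involutive j)
    (CycAdj-opposite l (opposite j) (opposite i) c)

opposite-injective : ∀ {n} → Injective _≡_ _≡_ (opposite {n})
opposite-injective {x = i} {j} eq =
  trans (sym (Fin.opposite-involutive i)) (trans (cong opposite eq) (Fin.opposite-involutive j))

transpose-cycle : ∀ G l → HasInducedCycle G l → HasInducedCycle (transpose G) l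
transpose-cycle G l (xs , ys , xs-inj , ys-inj , adj) =
  ys ∘ opposite , xs ∘ opposite , opposite-injective ∘ ys-inj , opposite-injective ∘ xs-inj ,
  λ i j → CycAdj-opposite⁻¹ l i j ∘ proj₁ (adj (opposite j) (opposite i)) ,
          proj₂ (adj (opposite j) (opposite i)) ∘ CycAdj-opposite l i j

transpose-ACB : ∀ G → ACB G → ACB (transpose G)
transpose-ACB G (c , c′) =
  (λ l → c l ∘ transpose-cycle (transpose G) l) ,
  (λ l → c′ l ∘ transpose-cycle (mir (transpose G)) l)

-- Hexagons, their mirrors and octagons

CycAdj? : ∀ l i j → Dec (CycAdj l i j)
CycAdj? l i j = (toℕ j ℕ.≟ toℕ i) ⊎-dec (toℕ j ℕ.≟ suc (toℕ i) % (3 + l))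

-- Injectivity of `xs` and `ys` comes from the pattern: equal vertices have equal neighbourhoods,
-- but on the cycle no row or column is contained in another. For a fixed `l` this last fact is
-- checked by computation.
inducedCycle : ∀ G l (xs : Fin (3 + l) → Fin (m G)) (ys : Fin (3 + l) → Fin (n G)) →
  (∀ i i′ → (∀ j → CycAdj l i j → CycAdj l i′ j) → i ≡ i′) →
  (∀ j j′ → (∀ i → CycAdj l i j → CycAdj l i j′) → j ≡ j′) →
  (∀ i j → E G (xs i) (ys j) ≡ does (CycAdj? l i j)) → HasInducedCycle G l
inducedCycle G l xs ys rows columns pat =
  xs , ys ,
  (λ {i} {i′} eq → rows i i′ λ j c → to i′ j (subst (λ x → Adj G x (ys j)) eq (from i j c))) ,
  (λ {j} {j′} eq → columns j j′ λ i c → to i j′ (subst (Adj G (xs i)) eq (from i j c))) ,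
  λ i j → to i j , from i j
  where
  from : ∀ i j → CycAdj l i j → Adj G (xs i) (ys j)
  from i j c = trans (pat i j) (dec-true (CycAdj? l i j) c)

  to : ∀ i j → Adj G (xs i) (ys j) → CycAdj l i j
  to i j a with CycAdj? l i j
  ... | yes c = c
  ... | no ¬c = contradiction (trans (sym a) (trans (pat i j) (dec-false (CycAdj? l i j) ¬c))) λ ()

rows? : ∀ l → Dec (∀ i i′ → (∀ j → CycAdj l i j → CycAdj l i′ j) → i ≡ i′)
rows? l = Fin.all? λ i → Fin.all? λ i′ →
  Fin.all? (λ j → CycAdj? l i j →-dec CycAdj? l i′ j) →-dec (i Fin.≟ i′)

columns? : ∀ l → Dec (∀ j j′ → (∀ i → CycAdj l i j → CycAdj l i j′) → j ≡ j′)
columns? l = Fin.all? λ j → Fin.all? λ j′ →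
  Fin.all? (λ i → CycAdj? l i j →-dec CycAdj? l i j′) →-dec (j Fin.≟ j′)

-- C₆ is K₃,₃ minus a perfect matching: each of `p`, `q`, `r` misses exactly one of `a`, `b`, `c`.
-- Applied to the mirror, each sees exactly one.
hexagon-free : ∀ G → ChordalBipartite G → ∀ {a b c p q r} →
  E G a p ≡ false → E G b p ≡ true  → E G c p ≡ true  →
  E G a q ≡ true  → E G b q ≡ false → E G c q ≡ true  →
  ¬ (E G a r ≡ true × E G b r ≡ true × E G c r ≡ false)
hexagon-free G chordal {a} {b} {c} {p} {q} {r} ap bp cp aq bq cq (ar , br , cr) =
  chordal 0 (inducedCycle G 0 (a ∷ b ∷ c ∷ []) (q ∷ r ∷ p ∷ [])
    (from-yes (rows? 0)) (from-yes (columns? 0)) λ where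
      0F 0F → aq ; 0F 1F → ar ; 0F 2F → ap
      1F 0F → bq ; 1F 1F → br ; 1F 2F → bp
      2F 0F → cq ; 2F 1F → cr ; 2F 2F → cp)

octagon-free : ∀ G → ChordalBipartite G → ∀ {a b c d p q r s} →
  E G a p ≡ true  → E G b p ≡ false → E G c p ≡ false → E G d p ≡ true  →
  E G a q ≡ true  → E G b q ≡ true  → E G c q ≡ false → E G d q ≡ false →
  E G a r ≡ false → E G b r ≡ true  → E G c r ≡ true  → E G d r ≡ false →
  ¬ (E G a s ≡ false × E G b s ≡ false × E G c s ≡ true × E G d s ≡ true)
octagon-free G chordal {a} {b} {c} {d} {p} {q} {r} {s}
  ap bp cp dp aq bq cq dq ar br cr dr (as , bs , cs , ds) =
  chordal 1 (inducedCycle G 1 (a ∷ b ∷ c ∷ d ∷ []) (p ∷ q ∷ r ∷ s ∷ [])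
    (from-yes (rows? 1)) (from-yes (columns? 1)) λ where
      0F 0F → ap ; 0F 1F → aq ; 0F 2F → ar ; 0F 3F → as
      1F 0F → bp ; 1F 1F → bq ; 1F 2F → br ; 1F 3F → bs
      2F 0F → cp ; 2F 1F → cq ; 2F 2F → cr ; 2F 3F → cs
      3F 0F → dp ; 3F 1F → dq ; 3F 2F → dr ; 3F 3F → ds)

-- Betweenness

Between : (G : BGraph) → (a b c : Fin (m G)) → Set
Between G a b c = ∀ y → E G b y ≡ E G a y ⊎ E G b y ≡ E G c y

Between? : ∀ G a b c → Dec (Between G a b c)
Between? G a b c = Fin.all? λ y → (E G b y ≟ E G a y) ⊎-dec (E G b y ≟ E G c y)

Between-sym : ∀ G {a b c} → Between G a b c → Between G c b a
Between-sym G abc y = Sum.swap (abc y)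

-- Betweenness is that of the Hamming distance on rows of the adjacency matrix, so these laws hold
-- columnwise in every graph.
Between-shrinkʳ : ∀ G {a b c d} → Between G a b c → Between G a c d → Between G a b d
Between-shrinkʳ G abc acd y with abc y | acd y
... | inj₁ ba | _       = inj₁ ba
... | inj₂ bc | inj₁ ca = inj₁ (trans bc ca)
... | inj₂ bc | inj₂ cd = inj₂ (trans bc cd)

Between-shrinkˡ : ∀ G {a b c d} → Between G a b c → Between G a c d → Between G b c d
Between-shrinkˡ G abc acd y with abc y | acd y
... | _       | inj₂ cd = inj₂ cd
... | inj₂ bc | inj₁ _  = inj₁ (sym bc)
... | inj₁ ba | inj₁ ca = inj₁ (trans ca (sym ba))

Between-antisym : ∀ G {a b c} → Between G a b c → Between G b a c → ∀ y → E G a y ≡ E G b y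
Between-antisym G abc bac y with abc y | bac y
... | inj₁ ba | _       = sym ba
... | inj₂ _  | inj₁ ab = ab
... | inj₂ bc | inj₂ ac = trans ac (sym bc)

-- Incomparable neighbourhoods and middle vertices

Diff : (G : BGraph) → (a b : Fin (m G)) → Set
Diff G a b = ∃ λ y → E G a y ≡ true × E G b y ≡ false

Incomp : (G : BGraph) → (a b : Fin (m G)) → Set
Incomp G a b = Diff G a b × Diff G b a

Incomp-sym : ∀ G {a b} → Incomp G a b → Incomp G b a
Incomp-sym G = Prod.swap

Diff⇒⊈ : ∀ G {a b} → Diff G a b → ¬ NX⊆ G a b
Diff⇒⊈ G (y , ay , by) a⊆b = contradiction (trans (sym by) (a⊆b y ay)) λ ()

⊈⇒Diff : ∀ G {a b} → ¬ NX⊆ G a b → Diff G a b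
⊈⇒Diff G {a} {b} a⊈b with Fin.any? (λ y → (E G a y ≟ true) ×-dec (E G b y ≟ false))
... | yes d = d
... | no ¬d = contradiction (λ y ay → ¬-not λ by → ¬d (y , ay , by)) a⊈b

Diff-irrefl : ∀ G {a b} → Diff G a b → ¬ (∀ y → E G a y ≡ E G b y)
Diff-irrefl G d eq = Diff⇒⊈ G d λ y ay → trans (sym (eq y)) ay

Private : (G : BGraph) → (a b c : Fin (m G)) → Set
Private G a b c = ∃ λ y → E G a y ≡ false × E G b y ≡ true × E G c y ≡ false

Private? : ∀ G a b c → Dec (Private G a b c)
Private? G a b c = Fin.any? λ y → (E G a y ≟ false) ×-dec (E G b y ≟ true) ×-dec (E G c y ≟ false)

-- The witnesses of N(b) ⊈ N(a) and N(b) ⊈ N(c) together with a vertex seeing a and c but not b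
-- would span a hexagon.
noPrivate⇒Between : ∀ G → ChordalBipartite G → ∀ {a b c} → Diff G b a → Diff G b c →
  ¬ Private G a b c → Between G a b c
noPrivate⇒Between G chordal {a} {b} {c} (p , bp , ap) (r , br , cr) ¬priv y
  with E G a y in ay | E G b y in by | E G c y in cy
... | true  | true  | _     = inj₁ refl
... | false | false | _     = inj₁ refl
... | _     | true  | true  = inj₂ refl
... | _     | false | false = inj₂ refl
... | false | true  | false = contradiction (y , ay , by , cy) ¬priv
... | true  | false | true  =
  contradiction (ar , br , cr) (hexagon-free G chordal ap bp cp ay by cy)
  where
  cp : E G c p ≡ true
  cp = ¬-not λ cp≡f → ¬priv (p , ap , bp , cp≡f)
  ar : E G a r ≡ true
  ar = ¬-not λ ar≡f → ¬priv (r , ar≡f , br , cr)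

-- A vertex without a private neighbour is in the middle. If all three had one, the private
-- neighbours would form a hexagon in the mirror.
betweenness-total : ∀ G → ACB G → ∀ {a b c} → Incomp G a b → Incomp G b c → Incomp G a c →
  Between G a b c ⊎ Between G b a c ⊎ Between G a c b
betweenness-total G (chordal , mir-chordal) {a} {b} {c} (a∖b , b∖a) (b∖c , c∖b) (a∖c , c∖a)
  with Private? G a b c | Private? G b a c | Private? G a c b
... | no ¬p | _ | _ = inj₁ (noPrivate⇒Between G chordal b∖a b∖c ¬p)
... | yes _ | no ¬p | _ = inj₂ (inj₁ (noPrivate⇒Between G chordal a∖b a∖c ¬p))
... | yes _ | yes _ | no ¬p = inj₂ (inj₂ (noPrivate⇒Between G chordal c∖a c∖b ¬p))
... | yes (q , aq , bq , cq) | yes (p , bp , ap , cp) | yes (r , ar , cr , br) =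
  contradiction (cong not ar , cong not br , cong not cr)
    (hexagon-free (mir G) mir-chordal
      (cong not ap) (cong not bp) (cong not cp) (cong not aq) (cong not bq) (cong not cq))

-- With `u` in the middle, a column changes value at most once from `v` through `u` to `w`; if it
-- changes after `u`, it does not change before.
agree : ∀ {u v w z : Bool} → u ≡ v ⊎ u ≡ w → u ≡ z → w ≡ not z → v ≡ z
agree (inj₁ uv) uz _ = trans (sym uv) uz
agree (inj₂ uw) uz wz = contradiction (trans (sym uz) (trans uw wz)) (not-¬ refl)

-- For each cyclically consecutive pair, take a column that sees the later vertex and misses the
-- earlier one. The betweennesses on either side force it to see the next vertex too and miss the
-- remaining one, so the four columns form an octagon.
no-cyclic-betweenness : ∀ G → ChordalBipartite G → ∀ {a b c d} →
  Incomp G a d → Incomp G b a → Incomp G c b → Incomp G d c →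
  Between G d a b → Between G a b c → Between G b c d → ¬ Between G c d a
no-cyclic-betweenness G chordal {a} {b} {c} {d}
  ((q , aq , dq) , _) ((r , br , ar) , _) ((s , cs , bs) , _) ((p , dp , cp) , _) dab abc bcd cda =
  octagon-free G chordal
    ap bp cp dp aq bq cq dq ar br cr dr (as , bs , cs , ds)
  where
  bq = agree (Sum.swap (dab q)) aq dq
  cq = agree (cda q) dq aq
  cr = agree (Sum.swap (abc r)) br ar
  dr = agree (dab r) ar br
  ds = agree (Sum.swap (bcd s)) cs bs
  as = agree (abc s) bs cs
  ap = agree (Sum.swap (cda p)) dp cp
  bp = agree (bcd p) cp dp

-- Were the middle of `a`, `b`, `d` not `b`, each arrangement would give two vertices equal
-- neighbourhoods, except `b a d` combined with `c d a`: that one is the cyclic arrangement excluded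
-- by the octagon.
Between-extend : ∀ G → ACB G → ∀ {a b c d} →
  Incomp G a b → Incomp G a d → Incomp G b c → Incomp G b d → Incomp G c d → Incomp G a c →
  Between G a b c → Between G b c d → Between G a b d
Between-extend G acb ab ad bc bd cd ac abc bcd with betweenness-total G acb ab bd ad
... | inj₁ abd = abd
... | inj₂ (inj₂ adb) = contradiction
  (Between-antisym G (Between-sym G (Between-shrinkˡ G adb abc)) bcd) (Diff-irrefl G (proj₂ bc))
... | inj₂ (inj₁ bad) with betweenness-total G acb cd (Incomp-sym G ad) (Incomp-sym G ac)
...   | inj₁ cda = contradiction cda
  (no-cyclic-betweenness G (proj₁ acb) ad (Incomp-sym G ab) (Incomp-sym G bc) (Incomp-sym G cd)
    (Between-sym G bad) abc bcd)
...   | inj₂ (inj₁ dca) = contradiction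
  (Between-antisym G (Between-shrinkʳ G abc (Between-sym G dca)) bad) (Diff-irrefl G (proj₁ ab))
...   | inj₂ (inj₂ cad) = contradiction
  (Between-antisym G
    (Between-sym G (Between-shrinkˡ G (Between-sym G cad) (Between-sym G bcd)))
    (Between-sym G abc))
  (Diff-irrefl G (proj₁ bc))

-- Ordering an antichain

Incomparable : (G : BGraph) {k : ℕ} → (Fin k → Fin (m G)) → Set
Incomparable G f = ∀ i j → i ≢ j → Diff G (f i) (f j)

SameSide : (G : BGraph) → (e a b : Fin (m G)) → Set
SameSide G e a b = Between G e a b ⊎ Between G e b a

SameSide? : ∀ G e a b → Dec (SameSide G e a b)
SameSide? G e a b = Between? G e a b ⊎-dec Between? G e b a

Endpoint : (G : BGraph) {k : ℕ} → (Fin k → Fin (m G)) → Fin k → Set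
Endpoint G f e = ∀ i j → SameSide G (f e) (f i) (f j)

-- Induction, adding a vertex `z` to an antichain with endpoint `e`. Either `e` remains an endpoint,
-- or `e` lies between `z` and some `a`. Then `e` lies between `z` and every other vertex, so the
-- order seen from `e` is also the order seen from `z`, and `z` is an endpoint.
endpoint : ∀ G → ACB G → ∀ {k} (f : Fin (suc k) → Fin (m G)) → Incomparable G f → ∃ (Endpoint G f)
endpoint G acb {zero} f inc = 0F , λ { 0F 0F → inj₁ λ _ → inj₁ refl }
endpoint G acb {suc k} f inc with endpoint G acb (f ∘ suc) (λ i j i≢j → inc _ _ (i≢j ∘ Fin.suc-injective))
... | e , end with Fin.all? (λ i → SameSide? G (f (suc e)) (f 0F) (f (suc i)))
... | yes end₀ = suc e , λ where
  0F      0F      → inj₁ λ _ → inj₂ refl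
  0F      (suc j) → end₀ j
  (suc i) 0F      → Sum.swap (end₀ i)
  (suc i) (suc j) → end i j
... | no ¬end₀ with Fin.¬∀⟶∃¬ _ _ (λ i → SameSide? G (f (suc e)) (f 0F) (f (suc i))) ¬end₀
... | a , ¬end₀a = 0F , end′
  where
  inc± : ∀ {i j} → i ≢ j → Incomp G (f i) (f j)
  inc± i≢j = inc _ _ i≢j , inc _ _ (i≢j ∘ sym)

  e≢a : e ≢ a
  e≢a refl = ¬end₀a (inj₂ λ _ → inj₁ refl)

  zea : Between G (f 0F) (f (suc e)) (f (suc a))
  zea with betweenness-total G acb {f 0F} {f (suc e)} {f (suc a)}
             (inc± λ ()) (inc± (e≢a ∘ Fin.suc-injective)) (inc± λ ())
  ... | inj₁ zea = zea
  ... | inj₂ (inj₁ eza) = contradiction (inj₁ eza) ¬end₀a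
  ... | inj₂ (inj₂ zae) = contradiction (inj₂ (Between-sym G zae)) ¬end₀a

  zeb : ∀ b → Between G (f 0F) (f (suc e)) (f (suc b))
  zeb b with b Fin.≟ e | b Fin.≟ a | end a b
  ... | yes refl | _ | _ = λ _ → inj₂ refl
  ... | no _ | yes refl | _ = zea
  ... | no _ | no _ | inj₂ eba =
    Between-sym G (Between-shrinkˡ G (Between-sym G eba) (Between-sym G zea))
  ... | no b≢e | no b≢a | inj₁ eab =
    Between-extend G acb (inc± λ ()) (inc± λ ()) (inc± (e≢a ∘ Fin.suc-injective))
      (inc± (b≢e ∘ sym ∘ Fin.suc-injective)) (inc± (b≢a ∘ sym ∘ Fin.suc-injective)) (inc± λ ())
      zea eab

  through : ∀ {i} j → Between G (f (suc e)) (f (suc i)) (f (suc j)) →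
    Between G (f 0F) (f (suc i)) (f (suc j))
  through j eij = Between-sym G (Between-shrinkʳ G (Between-sym G eij) (Between-sym G (zeb j)))

  end′ : Endpoint G f 0F
  end′ 0F      j       = inj₁ λ _ → inj₁ refl
  end′ (suc i) 0F      = inj₂ λ _ → inj₁ refl
  end′ (suc i) (suc j) = Sum.map (through j) (through i) (end i j)

module _ {A : Set} (R : A → A → Set) (total : ∀ a b → R a b ⊎ R b a)
         (R-trans : ∀ {a b c} → R a b → R b c → R a c) where

  least : ∀ {k} (f : Fin (suc k) → A) → ∃ λ i → ∀ j → R (f i) (f j)
  least {zero} f = 0F , λ { 0F → Sum.reduce (total (f 0F) (f 0F)) }
  least {suc k} f with least (f ∘ suc)
  ... | i , i≤ with total (f 0F) (f (suc i))
  ...   | inj₁ 0≤i = 0F , λ where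
    0F      → Sum.reduce (total (f 0F) (f 0F))
    (suc j) → R-trans 0≤i (i≤ j)
  ...   | inj₂ i≤0 = suc i , λ { 0F → i≤0 ; (suc j) → i≤ j }

  sorting : ∀ {k} (f : Fin k → A) → ∃ λ (σ : Fin k → Fin k) →
    Injective _≡_ _≡_ σ × (∀ {i j} → toℕ i ≤ toℕ j → R (f (σ i)) (f (σ j)))
  sorting {zero} f = id , (λ { {()} }) , λ { {()} }
  sorting {suc k} f with least f
  ... | i₀ , i₀≤ with sorting (f ∘ punchIn i₀)
  ... | σ , σ-inj , σ-mono = τ , τ-inj , τ-mono
    where
    τ : Fin (suc k) → Fin (suc k)
    τ 0F      = i₀
    τ (suc i) = punchIn i₀ (σ i)

    τ-inj : Injective _≡_ _≡_ τ
    τ-inj {0F}    {0F}    _  = refl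
    τ-inj {0F}    {suc j} eq = contradiction (sym eq) (Fin.punchInᵢ≢i i₀ (σ j))
    τ-inj {suc i} {0F}    eq = contradiction eq (Fin.punchInᵢ≢i i₀ (σ i))
    τ-inj {suc i} {suc j} eq = cong suc (σ-inj (Fin.punchIn-injective i₀ _ _ eq))

    τ-mono : ∀ {i j} → toℕ i ≤ toℕ j → R (f (τ i)) (f (τ j))
    τ-mono {0F}    {j}     _         = i₀≤ (τ j)
    τ-mono {suc i} {suc j} (s≤s i≤j) = σ-mono i≤j

Linear : (G : BGraph) {k : ℕ} → (Fin k → Fin (m G)) → Set
Linear G f = ∀ {i j l} → toℕ i ≤ toℕ j → toℕ j ≤ toℕ l → Between G (f i) (f j) (f l)

-- Seen from an endpoint `e`, the relation "`e`, then `a`, then `b`" is a total preorder. Sorting by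
-- it orders the antichain, and `Between-shrinkˡ` removes `e` from the resulting betweennesses.
linearise : ∀ G → ACB G → ∀ {k} (f : Fin k → Fin (m G)) → Incomparable G f →
  ∃ λ (h : Fin k → Fin (m G)) → Incomparable G h × Linear G h
linearise G acb {zero} f inc = f , inc , λ { {()} }
linearise G acb {suc k} f inc with endpoint G acb f inc
... | e , end with sorting (λ i j → Between G (f e) (f i) (f j)) end (Between-shrinkʳ G) id
... | σ , σ-inj , σ-mono =
  f ∘ σ , (λ i j i≢j → inc _ _ (i≢j ∘ σ-inj)) ,
  λ i≤j j≤l → Between-shrinkˡ G (σ-mono i≤j) (σ-mono j≤l)

-- The graphs Bₖ

Bk-adj : ∀ k {i w} → toℕ i ≤ toℕ w → toℕ w ≤ toℕ i + k → Adj (Bk (2 + k)) i w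
Bk-adj k i≤w w≤i+k = Equivalence.to T-≡ (Equivalence.from T-∧ (ℕ.≤⇒≤ᵇ i≤w , ℕ.≤⇒≤ᵇ w≤i+k))

Bk-adj⁻¹ : ∀ k {i w} → Adj (Bk (2 + k)) i w → toℕ i ≤ toℕ w × toℕ w ≤ toℕ i + k
Bk-adj⁻¹ k iw with Equivalence.to T-∧ (Equivalence.from T-≡ iw)
... | i≤w , w≤i+k = ℕ.≤ᵇ⇒≤ _ _ i≤w , ℕ.≤ᵇ⇒≤ _ _ w≤i+k

Bk-nonadj-< : ∀ k {i w} → toℕ w < toℕ i → E (Bk (2 + k)) i w ≡ false
Bk-nonadj-< k {i} {w} w<i = ¬-not (ℕ.<⇒≱ w<i ∘ proj₁ ∘ Bk-adj⁻¹ k {i} {w})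

Bk-nonadj-> : ∀ k {i w} → toℕ i + k < toℕ w → E (Bk (2 + k)) i w ≡ false
Bk-nonadj-> k {i} {w} i+k<w = ¬-not (ℕ.<⇒≱ i+k<w ∘ proj₂ ∘ Bk-adj⁻¹ k {i} {w})

row≤ : ∀ k (i : Fin (2 + k)) → toℕ i ≤ suc k
row≤ k i = ℕ.≤-pred (Fin.toℕ<n i)

columns≡ : ∀ k → 2 * (2 + k) ∸ 2 ≡ suc k + suc k
columns≡ k = trans (ℕ.+-suc k (suc (k + 0))) (cong (λ t → suc (k + suc t)) (ℕ.+-identityʳ k))

column< : ∀ k (w : Fin (n (Bk (2 + k)))) → toℕ w < suc k + suc k
column< k w = subst (toℕ w <_) (columns≡ k) (Fin.toℕ<n w)

column : ∀ k w → w < suc k + suc k → Fin (n (Bk (2 + k)))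
column k w w< = fromℕ< (subst (w <_) (sym (columns≡ k)) w<)

toℕ-column : ∀ k w (w< : w < suc k + suc k) → toℕ (column k w w<) ≡ w
toℕ-column k w w< = Fin.toℕ-fromℕ< _

-- The first column of a row is missed by all later rows, its last column by all earlier ones.
Bk-Diff : ∀ k {i j} → i ≢ j → Diff (Bk (2 + k)) i j
Bk-Diff k {i} {j} i≢j with ℕ.<-cmp (toℕ i) (toℕ j)
... | tri≈ _ i≡j _ = contradiction (Fin.toℕ-injective i≡j) i≢j
... | tri< i<j _ _ = w ,
  Bk-adj k (ℕ.≤-reflexive (sym w≡i)) (ℕ.≤-trans (ℕ.≤-reflexive w≡i) (ℕ.m≤m+n _ k)) ,
  Bk-nonadj-< k {j} {w} (subst (_< toℕ j) (sym w≡i) i<j)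
  where
  i<2k+2 : toℕ i < suc k + suc k
  i<2k+2 = ℕ.<-≤-trans i<j (ℕ.≤-trans (row≤ k j) (ℕ.m≤m+n (suc k) (suc k)))
  w = column k (toℕ i) i<2k+2
  w≡i : toℕ w ≡ toℕ i
  w≡i = toℕ-column k (toℕ i) i<2k+2
... | tri> _ _ j<i = w ,
  Bk-adj k (ℕ.≤-trans (ℕ.m≤m+n _ k) (ℕ.≤-reflexive (sym w≡i+k))) (ℕ.≤-reflexive w≡i+k) ,
  Bk-nonadj-> k {j} {w} (subst (toℕ j + k <_) (sym w≡i+k) (ℕ.+-monoˡ-< k j<i))
  where
  i+k<2k+2 : toℕ i + k < suc k + suc k
  i+k<2k+2 = ℕ.+-mono-≤-< (row≤ k i) (ℕ.n<1+n k)
  w = column k (toℕ i + k) i+k<2k+2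
  w≡i+k : toℕ w ≡ toℕ i + k
  w≡i+k = toℕ-column k (toℕ i + k) i+k<2k+2

consecutive-≤ : ∀ {k} {i j : Fin k} → toℕ j ≡ suc (toℕ i) → toℕ i ≤ toℕ j
consecutive-≤ j≡1+i = ℕ.≤-trans (ℕ.n≤1+n _) (ℕ.≤-reflexive (sym j≡1+i))

consecutive-≢ : ∀ {k} {i j : Fin k} → toℕ j ≡ suc (toℕ i) → i ≢ j
consecutive-≢ j≡1+i refl = ℕ.1+n≢n (sym j≡1+i)

-- A column `w ≤ k` is seen by exactly the rows up to `w`, and a column `w > k` by exactly the rows
-- from `w - k` on. So each column separates one pair of consecutive rows, and the two cases record
-- which side sees it.
column-cut : ∀ k (w : Fin (n (Bk (2 + k)))) → ∃₂ λ (i j : Fin (2 + k)) →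
  toℕ j ≡ suc (toℕ i) × (toℕ w ≡ toℕ i ⊎ toℕ w ≡ toℕ j + k)
column-cut k w with toℕ w ℕ.≤? k
... | yes w≤k =
  fromℕ< w<2+k , fromℕ< (s≤s (s≤s w≤k)) ,
  trans (Fin.toℕ-fromℕ< (s≤s (s≤s w≤k))) (cong suc (sym (Fin.toℕ-fromℕ< w<2+k))) , inj₁ (sym (Fin.toℕ-fromℕ< _))
  where
  w<2+k : toℕ w < 2 + k
  w<2+k = ℕ.m≤n⇒m≤1+n (s≤s w≤k)
... | no w≰k =
  fromℕ< t<2+k , fromℕ< (s≤s t<1+k) ,
  trans (Fin.toℕ-fromℕ< (s≤s t<1+k)) (cong suc (sym (Fin.toℕ-fromℕ< t<2+k))) ,
  inj₂ (trans (sym (ℕ.m∸n+n≡m (ℕ.≰⇒> w≰k)))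
         (trans (ℕ.+-suc t k) (cong (_+ k) (sym (Fin.toℕ-fromℕ< (s≤s t<1+k))))))
  where
  t = toℕ w ∸ suc k
  t<1+k : t < suc k
  t<1+k = ℕ.+-cancelʳ-< (suc k) t (suc k)
    (subst (_< suc k + suc k) (sym (ℕ.m∸n+n≡m (ℕ.≰⇒> w≰k))) (column< k w))
  t<2+k : t < 2 + k
  t<2+k = ℕ.m≤n⇒m≤1+n t<1+k

-- For consecutive rows each of the two differences is a single column: the first of the earlier row
-- and the last of the later row. Every `w` arises in this way.
Bk-column-critical : ∀ k w → ∃₂ λ a b → a ≢ b ×
  (∀ u → u ≢ w → Adj (Bk (2 + k)) a u → Adj (Bk (2 + k)) b u)
Bk-column-critical k w with column-cut k w
... | i , j , j≡1+i , inj₁ w≡i = i , j , consecutive-≢ j≡1+i , λ u u≢w iu →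
  let i≤u , u≤i+k = Bk-adj⁻¹ k {i} {u} iu in
  Bk-adj k {j} {u}
    (subst (_≤ toℕ u) (sym j≡1+i)
      (ℕ.≤∧≢⇒< i≤u λ i≡u → u≢w (Fin.toℕ-injective (trans (sym i≡u) (sym w≡i)))))
    (ℕ.≤-trans u≤i+k (ℕ.+-monoˡ-≤ k (consecutive-≤ j≡1+i)))
... | i , j , j≡1+i , inj₂ w≡j+k = j , i , consecutive-≢ j≡1+i ∘ sym , λ u u≢w ju →
  let j≤u , u≤j+k = Bk-adj⁻¹ k {j} {u} ju in
  Bk-adj k {i} {u} (ℕ.≤-trans (consecutive-≤ j≡1+i) j≤u)
    (ℕ.≤-pred (subst (λ t → toℕ u < t + k) j≡1+i
      (ℕ.≤∧≢⇒< u≤j+k λ u≡j+k → u≢w (Fin.toℕ-injective (trans u≡j+k (sym w≡j+k))))))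

-- A twin `v` of `w` would still witness the difference that is lost on deleting `w`.
Bk-columns-distinct : ∀ k v w → (∀ i → E (Bk (2 + k)) i v ≡ E (Bk (2 + k)) i w) → v ≡ w
Bk-columns-distinct k v w v≈w with v Fin.≟ w | Bk-column-critical k w
... | yes v≡w | _ = v≡w
... | no v≢w | a , b , a≢b , a⊆b with Bk-Diff k a≢b
...   | u , au , bu with u Fin.≟ w
...     | no u≢w = contradiction (trans (sym bu) (a⊆b u u≢w au)) λ ()
...     | yes refl = contradiction
  (trans (sym bu) (trans (sym (v≈w b)) (a⊆b v v≢w (trans (v≈w a) au)))) λ ()

-- Finding Bₖ in a linearly ordered antichain

linear-cut : ∀ G {k} (h : Fin k → Fin (m G)) → Linear G h → ∀ {i j y b} →
  toℕ j ≡ suc (toℕ i) → E G (h i) y ≡ b → E G (h j) y ≡ not b →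
  (∀ l → toℕ l ≤ toℕ i → E G (h l) y ≡ b) × (∀ l → toℕ j ≤ toℕ l → E G (h l) y ≡ not b)
linear-cut G h lin {i} {j} {y} {b} j≡1+i iy jy =
  (λ l l≤i → agree (lin {l} {i} {j} l≤i i≤j y) iy jy) ,
  (λ l j≤l → agree (Sum.swap (lin {i} {j} {l} i≤j j≤l y)) jy (trans iy (sym (not-involutive b))))
  where i≤j = consecutive-≤ {i = i} {j} j≡1+i

-- Column `w` of Bₖ is determined by its cut and the side that sees it. Incomparability of the two
-- vertices at the cut supplies a `y` with the same values there, and linearity makes it constant on
-- either side.
linear-column : ∀ G k (h : Fin (2 + k) → Fin (m G)) → Incomparable G h → Linear G h →
  ∀ w → ∃ λ y → ∀ i → E G (h i) y ≡ E (Bk (2 + k)) i w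
linear-column G k h inc lin w with column-cut k w
... | i , j , j≡1+i , inj₁ w≡i = y , trace
  where
  diff = inc i j (consecutive-≢ j≡1+i)
  y = proj₁ diff
  cut = linear-cut G h lin {i} {j} j≡1+i (proj₁ (proj₂ diff)) (proj₂ (proj₂ diff))

  trace : ∀ l → E G (h l) y ≡ E (Bk (2 + k)) l w
  trace l with toℕ l ℕ.≤? toℕ i
  ... | yes l≤i = trans (proj₁ cut l l≤i) (sym (Bk-adj k {l} {w}
    (subst (toℕ l ≤_) (sym w≡i) l≤i)
    (ℕ.≤-trans (ℕ.≤-pred (subst (_≤ suc k) (trans j≡1+i (cong suc (sym w≡i))) (row≤ k j)))
      (ℕ.m≤n+m k (toℕ l)))))
  ... | no l≰i = trans (proj₂ cut l (subst (_≤ toℕ l) (sym j≡1+i) (ℕ.≰⇒> l≰i)))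
    (sym (Bk-nonadj-< k {l} {w} (subst (_< toℕ l) (sym w≡i) (ℕ.≰⇒> l≰i))))
... | i , j , j≡1+i , inj₂ w≡j+k = y , trace
  where
  diff = inc j i (consecutive-≢ j≡1+i ∘ sym)
  y = proj₁ diff
  cut = linear-cut G h lin {i} {j} j≡1+i (proj₂ (proj₂ diff)) (proj₁ (proj₂ diff))

  trace : ∀ l → E G (h l) y ≡ E (Bk (2 + k)) l w
  trace l with toℕ l ℕ.≤? toℕ i
  ... | yes l≤i = trans (proj₁ cut l l≤i) (sym (Bk-nonadj-> k {l} {w}
    (subst (toℕ l + k <_) (sym w≡j+k)
      (ℕ.+-monoˡ-< k (subst (toℕ l <_) (sym j≡1+i) (s≤s l≤i))))))
  ... | no l≰i = trans (proj₂ cut l j≤l) (sym (Bk-adj k {l} {w}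
    (ℕ.≤-trans (row≤ k l) (subst (suc k ≤_) (trans (cong (_+ k) (sym j≡1+i)) (sym w≡j+k))
      (s≤s (ℕ.m≤n+m k (toℕ i)))))
    (subst (_≤ toℕ l + k) (sym w≡j+k) (ℕ.+-monoˡ-≤ k j≤l))))
    where
    j≤l : toℕ j ≤ toℕ l
    j≤l = subst (_≤ toℕ l) (sym j≡1+i) (ℕ.≰⇒> l≰i)

-- Deleting a vertex outside an antichain

Incomparable⇒injective : ∀ G {k} (f : Fin k → Fin (m G)) → Incomparable G f → Injective _≡_ _≡_ f
Incomparable⇒injective G f inc {i} {j} fi≡fj with i Fin.≟ j
... | yes i≡j = i≡j
... | no i≢j = contradiction (λ y → cong (λ x → E G x y) fi≡fj) (Diff-irrefl G (inc i j i≢j))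

Incomparable⇒Antichain : ∀ G {k} (f : Fin k → Fin (m G)) → Incomparable G f → AntichainX G k
Incomparable⇒Antichain G f inc =
  f , Incomparable⇒injective G f inc , λ i j i≢j → Diff⇒⊈ G (inc i j i≢j)

Antichain⇒Incomparable : ∀ G {k} (a : AntichainX G k) → Incomparable G (proj₁ a)
Antichain⇒Incomparable G (f , _ , inc) i j i≢j = ⊈⇒Diff G (inc i j i≢j)

delX-antichain : ∀ G x {k} (f : Fin k → Fin (m G)) → Incomparable G f → (∀ i → x ≢ f i) →
  AntichainX (delX G x) k
delX-antichain (bgraph (suc m) n e) x f inc x≢f =
  Incomparable⇒Antichain (delX (bgraph (suc m) n e) x) (λ i → punchOut (x≢f i)) λ i j i≢j →
    let y , iy , jy = inc i j i≢j in
    y , trans (cong (λ a → e a y) (Fin.punchIn-punchOut (x≢f i))) iy ,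
        trans (cong (λ a → e a y) (Fin.punchIn-punchOut (x≢f j))) jy

delY-antichain : ∀ G y {k} (f : Fin k → Fin (m G)) →
  (∀ i j → i ≢ j → ∃ λ v → y ≢ v × E G (f i) v ≡ true × E G (f j) v ≡ false) →
  AntichainX (delY G y) k
delY-antichain (bgraph m (suc n) e) y f inc =
  Incomparable⇒Antichain (delY (bgraph m (suc n) e) y) f λ i j i≢j →
    let v , y≢v , iv , jv = inc i j i≢j in
    punchOut y≢v , trans (cong (e (f i)) (Fin.punchIn-punchOut y≢v)) iv ,
                   trans (cong (e (f j)) (Fin.punchIn-punchOut y≢v)) jv

antichain≤BipDilw : ∀ G {d r} → BipDilw G d → AntichainX G r → r ≤ d
antichain≤BipDilw G (a , b , (_ , a-max) , _ , refl) c = ℕ.≤-trans (a-max _ c) (ℕ.m≤m⊔n a b)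

hit : ∀ {k n} (f : Fin k → Fin n) x → ¬ (∀ i → x ≢ f i) → ∃ λ i → f i ≡ x
hit f x ¬miss with Fin.any? (λ i → f i Fin.≟ x)
... | yes found = found
... | no ¬found = contradiction (λ i x≡fi → ¬found (i , sym x≡fi)) ¬miss

-- Injectivity follows because Bₖ has incomparable rows and distinct columns. Surjectivity is
-- criticality: a vertex outside the image could be deleted with the antichain `h` left intact.
embedding⇒iso : ∀ k G (h : Fin (2 + k) → Fin (m G)) (g : Fin (n (Bk (2 + k))) → Fin (n G)) →
  (∀ i w → E G (h i) (g w) ≡ E (Bk (2 + k)) i w) →
  (∀ x → ¬ AntichainX (delX G x) (2 + k)) → (∀ y → ¬ AntichainX (delY G y) (2 + k)) →
  IsoSame G (Bk (2 + k))
embedding⇒iso k G h g hg critX critY =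
  mk↔ₛ′ (proj₁ ∘ h⁻¹) h (λ i → h-inj (proj₂ (h⁻¹ (h i)))) (proj₂ ∘ h⁻¹) ,
  mk↔ₛ′ (proj₁ ∘ g⁻¹) g (λ w → g-inj (proj₂ (g⁻¹ (g w)))) (proj₂ ∘ g⁻¹) ,
  λ x y → trans (cong₂ (E G) (sym (proj₂ (h⁻¹ x))) (sym (proj₂ (g⁻¹ y)))) (hg _ _)
  where
  inc : Incomparable G h
  inc i j i≢j with Bk-Diff k i≢j
  ... | w , iw , jw = g w , trans (hg i w) iw , trans (hg j w) jw

  h-inj : Injective _≡_ _≡_ h
  h-inj = Incomparable⇒injective G h inc

  g-inj : Injective _≡_ _≡_ g
  g-inj {v} {w} gv≡gw = Bk-columns-distinct k v w λ i →
    trans (sym (hg i v)) (trans (cong (E G (h i)) gv≡gw) (hg i w))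

  h⁻¹ : ∀ x → ∃ λ i → h i ≡ x
  h⁻¹ x = hit h x λ x≢h → critX x (delX-antichain G x h inc x≢h)

  g⁻¹ : ∀ y → ∃ λ w → g w ≡ y
  g⁻¹ y = hit g y λ y≢g → critY y (delY-antichain G y h λ i j i≢j →
    let w , iw , jw = Bk-Diff k i≢j in
    g w , y≢g w , trans (hg i w) iw , trans (hg j w) jw)

linear⇒iso : ∀ k G → (∃ λ (h : Fin (2 + k) → Fin (m G)) → Incomparable G h × Linear G h) →
  (∀ x → ¬ AntichainX (delX G x) (2 + k)) → (∀ y → ¬ AntichainX (delY G y) (2 + k)) →
  IsoSame G (Bk (2 + k))
linear⇒iso k G (h , inc , lin) = embedding⇒iso k G h
  (λ w → proj₁ (linear-column G k h inc lin w))
  (λ i w → proj₂ (linear-column G k h inc lin w) i)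

critical⇒Bk : ∀ k G → KCriticalACB (2 + k) G → AntichainX G (2 + k) → IsoSame G (Bk (2 + k))
critical⇒Bk k G (acb , _ , critX , critY) antichain =
  linear⇒iso k G (linearise G acb (proj₁ antichain) (Antichain⇒Incomparable G antichain))
    (λ x → no-antichain (delX G x) (critX x)) (λ y → no-antichain (delY G y) (critY y))
  where
  no-antichain : ∀ H → (Σ ℕ λ d → BipDilw H d × d ≤ 1 + k) → ¬ AntichainX H (2 + k)
  no-antichain H (d , dilw , d≤) a = ℕ.<⇒≱ (antichain≤BipDilw H dilw a) d≤

-- Linearly ordered graphs are chordal bipartite

Ordered : ℕ → ℕ → ℕ → Set
Ordered p q r = (p ≤ q × q ≤ r) ⊎ (r ≤ q × q ≤ p)

median : ∀ p q r → Ordered q p r ⊎ Ordered p q r ⊎ Ordered p r q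
median p q r with ℕ.≤-total p q | ℕ.≤-total q r | ℕ.≤-total p r
... | inj₁ p≤q | inj₁ q≤r | _        = inj₂ (inj₁ (inj₁ (p≤q , q≤r)))
... | inj₁ p≤q | inj₂ r≤q | inj₁ p≤r = inj₂ (inj₂ (inj₁ (p≤r , r≤q)))
... | inj₁ p≤q | inj₂ r≤q | inj₂ r≤p = inj₁ (inj₂ (r≤p , p≤q))
... | inj₂ q≤p | inj₁ q≤r | inj₁ p≤r = inj₁ (inj₁ (q≤p , p≤r))
... | inj₂ q≤p | inj₁ q≤r | inj₂ r≤p = inj₂ (inj₂ (inj₂ (q≤r , r≤p)))
... | inj₂ q≤p | inj₂ r≤q | _        = inj₂ (inj₁ (inj₂ (r≤q , q≤p)))

-- The cyclic successor of index 3: it is 0 on the octagon and 4 on longer cycles, hence never 1 or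
-- 2.
4%[4+l] : ∀ l → 4 % (4 + l) ≡ 0 ⊎ 4 % (4 + l) ≡ 4
4%[4+l] zero    = inj₁ refl
4%[4+l] (suc _) = inj₂ refl

module _ (G : BGraph) (pos : Fin (m G) → ℕ)
         (lin : ∀ {a b c} → pos a ≤ pos b → pos b ≤ pos c → Between G a b c) where

  private
    between : ∀ {a b c} → Ordered (pos a) (pos b) (pos c) → Between G a b c
    between (inj₁ (a≤b , b≤c)) = lin a≤b b≤c
    between (inj₂ (c≤b , b≤a)) = Between-sym G (lin c≤b b≤a)

  -- The first four vertices of a cycle of length at least 8 can only be ordered as 1-0-3 and
  -- 2-3-0, and these two force 1-0-2, which the vertex joining 0 to its predecessor forbids.
  linear⇒chordal : ChordalBipartite G
  linear⇒chordal zero (xs , ys , _ , _ , adj) =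
    -- On a hexagon every vertex is missed by a column that sees the other two, so none of the three
    -- can be the middle one.
    [ missed 1F 0F 2F 2F [ (λ ()) , (λ ()) ]′ (inj₂ refl) (inj₁ refl)
    , [ missed 0F 1F 2F 0F [ (λ ()) , (λ ()) ]′ (inj₁ refl) (inj₂ refl)
      , missed 0F 2F 1F 1F [ (λ ()) , (λ ()) ]′ (inj₂ refl) (inj₁ refl) ]′ ]′
    (median (pos (xs 0F)) (pos (xs 1F)) (pos (xs 2F)))
    where
    missed : ∀ i j k w → ¬ CycAdj 0 j w → CycAdj 0 i w → CycAdj 0 k w →
      ¬ Ordered (pos (xs i)) (pos (xs j)) (pos (xs k))
    missed i j k w ¬jw iw kw o with between o (ys w)
    ... | inj₁ ji = ¬jw (proj₁ (adj j w) (trans ji (proj₂ (adj i w) iw)))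
    ... | inj₂ jk = ¬jw (proj₁ (adj j w) (trans jk (proj₂ (adj k w) kw)))
  linear⇒chordal (suc l) (xs , ys , _ , _ , adj) = combine
    ([ id , [ (λ o → contradiction o (separated 0F 1F 3F 2F (inj₂ refl) [ (λ ()) , (λ ()) ]′ 3≁2))
           , (λ o → contradiction o (separated 0F 3F 1F 3F (inj₁ refl)
               [ (λ ()) , (λ ()) ]′ [ (λ ()) , (λ ()) ]′))
           ]′ ]′ (median (p 0F) (p 1F) (p 3F)))
    ([ id , [ (λ o → contradiction o (separated 3F 2F 0F 2F (inj₁ refl) 3≁2 [ (λ ()) , (λ ()) ]′))
           , (λ o → contradiction o (separated 3F 0F 2F 1F (inj₂ refl) 3≁1 [ (λ ()) , (λ ()) ]′))
           ]′ ]′ (median (p 3F) (p 2F) (p 0F)))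
    where
    p : Fin (4 + l) → ℕ
    p i = pos (xs i)

    separated : ∀ i j k w → CycAdj (suc l) j w → ¬ CycAdj (suc l) i w → ¬ CycAdj (suc l) k w →
      ¬ Ordered (p i) (p j) (p k)
    separated i j k w jw ¬iw ¬kw o with between o (ys w)
    ... | inj₁ ji = ¬iw (proj₁ (adj i w) (trans (sym ji) (proj₂ (adj j w) jw)))
    ... | inj₂ jk = ¬kw (proj₁ (adj k w) (trans (sym jk) (proj₂ (adj j w) jw)))

    3≁1 : ¬ CycAdj (suc l) 3F 1F
    3≁1 (inj₁ ())
    3≁1 (inj₂ e) with 4%[4+l] l
    ... | inj₁ e′ = contradiction (trans e e′) λ ()
    ... | inj₂ e′ = contradiction (trans e e′) λ ()

    3≁2 : ¬ CycAdj (suc l) 3F 2F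
    3≁2 (inj₁ ())
    3≁2 (inj₂ e) with 4%[4+l] l
    ... | inj₁ e′ = contradiction (trans e e′) λ ()
    ... | inj₂ e′ = contradiction (trans e e′) λ ()

    ¬102 : ¬ Ordered (p 1F) (p 0F) (p 2F)
    ¬102 = separated 1F 0F 2F 0F (inj₁ refl) [ (λ ()) , (λ ()) ]′ [ (λ ()) , (λ ()) ]′

    ¬030 : ¬ Ordered (p 0F) (p 3F) (p 0F)
    ¬030 = separated 0F 3F 0F 3F (inj₁ refl) [ (λ ()) , (λ ()) ]′ [ (λ ()) , (λ ()) ]′

    combine : Ordered (p 1F) (p 0F) (p 3F) → ¬ Ordered (p 2F) (p 3F) (p 0F)
    -- Opposite orientations put 0 and 3 at the same position, although column 3 tells them apart.
    combine (inj₁ (_ , 0≤3))   (inj₁ (_ , 3≤0))   = ¬030 (inj₁ (0≤3 , 3≤0))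
    combine (inj₁ (1≤0 , 0≤3)) (inj₂ (_ , 3≤2))   = ¬102 (inj₁ (1≤0 , ℕ.≤-trans 0≤3 3≤2))
    combine (inj₂ (_ , 0≤1))   (inj₁ (2≤3 , 3≤0)) = ¬102 (inj₂ (ℕ.≤-trans 2≤3 3≤0 , 0≤1))
    combine (inj₂ (3≤0 , _))   (inj₂ (0≤3 , _))   = ¬030 (inj₁ (0≤3 , 3≤0))

-- Bounds on antichains

subgraph-antichain : ∀ G H (f : Fin (m H) → Fin (m G)) (g : Fin (n H) → Fin (n G)) →
  (∀ x y → E H x y ≡ E G (f x) (g y)) → ∀ {r} → AntichainX H r → AntichainX G r
subgraph-antichain G H f g eq (h , h-inj , inc) =
  Incomparable⇒Antichain G (f ∘ h) λ i j i≢j →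
    let y , iy , jy = Antichain⇒Incomparable H (h , h-inj , inc) i j i≢j in
    g y , trans (sym (eq _ _)) iy , trans (sym (eq _ _)) jy

delX-antichain⁻¹ : ∀ G x {r} → AntichainX (delX G x) r → AntichainX G r
delX-antichain⁻¹ (bgraph (suc m) n e) x =
  subgraph-antichain (bgraph (suc m) n e) (delX (bgraph (suc m) n e) x) (punchIn x) id λ _ _ → refl

delY-antichain⁻¹ : ∀ G y {r} → AntichainX (delY G y) r → AntichainX G r
delY-antichain⁻¹ (bgraph m (suc n) e) y =
  subgraph-antichain (bgraph m (suc n) e) (delY (bgraph m (suc n) e) y) id (punchIn y) λ _ _ → refl

-- The easy half of Dilworth's theorem: every colour class is a chain and so meets an antichain at
-- most once.
chain-cover : ∀ G {r s} (c : Fin (m G) → Fin r) →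
  (∀ a b → c a ≡ c b → NX⊆ G a b ⊎ NX⊆ G b a) → AntichainX G s → s ≤ r
chain-cover G c chain (f , _ , inc) = Fin.injective⇒≤ {f = c ∘ f} injective
  where
  injective : Injective _≡_ _≡_ (c ∘ f)
  injective {i} {j} eq with i Fin.≟ j
  ... | yes i≡j = i≡j
  ... | no i≢j with chain (f i) (f j) eq
  ...   | inj₁ i⊆j = contradiction i⊆j (inc i j i≢j)
  ...   | inj₂ j⊆i = contradiction j⊆i (inc j i (i≢j ∘ sym))

size-bound : ∀ G {s} → AntichainX G s → s ≤ m G
size-bound G (_ , f-inj , _) = Fin.injective⇒≤ f-inj

-- The colour classes are the pair `a`, `b` and singletons: indices are taken with `a` removed, and
-- `a` receives the colour of `b`.
comparable-pair : ∀ {m n} (e : Fin (suc m) → Fin n → Bool) {a b s} → a ≢ b →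
  let G = bgraph (suc m) n e in NX⊆ G a b → AntichainX G s → s ≤ m
comparable-pair {m} {n} e {a} {b} a≢b a⊆b = chain-cover G colour chain
  where
  G = bgraph (suc m) n e

  colour : Fin (suc m) → Fin m
  colour x with a Fin.≟ x
  ... | yes _  = punchOut a≢b
  ... | no a≢x = punchOut a≢x

  chain : ∀ x z → colour x ≡ colour z → NX⊆ G x z ⊎ NX⊆ G z x
  chain x z eq with a Fin.≟ x | a Fin.≟ z
  ... | yes refl | yes refl = inj₁ λ _ → id
  ... | yes refl | no a≢z with Fin.punchOut-injective a≢b a≢z eq
  ...   | refl = inj₁ a⊆b
  chain x z eq | no a≢x | yes refl with Fin.punchOut-injective a≢x a≢b eq
  ...   | refl = inj₂ a⊆b
  chain x z eq | no a≢x | no a≢z with Fin.punchOut-injective a≢x a≢z eq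
  ...   | refl = inj₁ λ _ → id

-- The bipartite Dilworth number exists

-- Exhaustive search over the values of `f` one argument at a time. Functions are rebuilt only up to
-- pointwise equality, hence the condition that `P` respects it.
search : ∀ {k r} {P : Vector (Fin k) r → Set} → (∀ {f g} → (∀ i → f i ≡ g i) → P f → P g) →
  (∀ f → Dec (P f)) → Dec (∃ P)
search {r = zero} resp P? with P? []
... | yes p = yes (_ , p)
... | no ¬p = no λ (f , p) → ¬p (resp (λ ()) p)
search {r = suc r} {P} resp P? with Fin.any? (λ a →
  search {P = λ f → P (a ∷ f)} (λ f≗g → resp λ { 0F → refl ; (suc i) → f≗g i }) (λ f → P? (a ∷ f)))
... | yes (a , f , p) = yes (_ , p)
... | no ¬p = no λ (f , p) → ¬p (head f , tail f , resp (λ { 0F → refl ; (suc i) → refl }) p)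

AntichainX? : ∀ G r → Dec (AntichainX G r)
AntichainX? G r = map′
  (λ (f , inc) → Incomparable⇒Antichain G f inc)
  (λ a → proj₁ a , Antichain⇒Incomparable G a)
  (search
    (λ f≗g inc i j i≢j → subst₂ (Diff G) (f≗g i) (f≗g j) (inc i j i≢j))
    (λ f → Fin.all? λ i → Fin.all? λ j → ¬? (i Fin.≟ j) →-dec
      Fin.any? λ y → (E G (f i) y ≟ true) ×-dec (E G (f j) y ≟ false)))

-- Lower the bound until an antichain of that size exists; the empty family stops the descent at 0.
bounded⇒NablaX : ∀ G r → (∀ s → AntichainX G s → s ≤ r) → ∃ λ a → NablaX G a × a ≤ r
bounded⇒NablaX G r bound with AntichainX? G r
... | yes a = r , (a , bound) , ℕ.≤-refl
bounded⇒NablaX G zero bound | no ¬a = contradiction ((λ ()) , (λ { {()} }) , λ ()) ¬a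
bounded⇒NablaX G (suc r) bound | no ¬a
  with bounded⇒NablaX G r (λ s c → ℕ.≤-pred (ℕ.≤∧≢⇒< (bound s c) λ { refl → ¬a c }))
... | a , nabla , a≤r = a , nabla , ℕ.m≤n⇒m≤1+n a≤r

bounded⇒BipDilw : ∀ G r → (∀ s → AntichainX G s → s ≤ r) → (∀ s → AntichainY G s → s ≤ r) →
  Σ ℕ λ d → BipDilw G d × d ≤ r
bounded⇒BipDilw G r boundX boundY
  with bounded⇒NablaX G r boundX | bounded⇒NablaX (transpose G) r boundY
... | a , nablaX , a≤r | b , nablaY , b≤r = a ⊔ b , (a , b , nablaX , nablaY , refl) , ℕ.⊔-lub a≤r b≤r

-- Bₖ is critical

-- Rows are intervals sliding to the right. A column inside the interval of `j` but beyond that of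
-- `i` has index at least `k + 1`, so it is not to the left of row `l`, and it lies in the interval
-- of `l`.
Bk-linear : ∀ k {i j l : Fin (2 + k)} → toℕ i ≤ toℕ j → toℕ j ≤ toℕ l → Between (Bk (2 + k)) i j l
Bk-linear k {i} {j} {l} i≤j j≤l w with toℕ j ℕ.≤? toℕ w | toℕ w ℕ.≤? toℕ j + k
... | no j≰w | _ = inj₂ (trans (Bk-nonadj-< k {j} {w} (ℕ.≰⇒> j≰w))
  (sym (Bk-nonadj-< k {l} {w} (ℕ.<-≤-trans (ℕ.≰⇒> j≰w) j≤l))))
... | yes _ | no w≰j+k = inj₁ (trans (Bk-nonadj-> k {j} {w} (ℕ.≰⇒> w≰j+k))
  (sym (Bk-nonadj-> k {i} {w} (ℕ.≤-<-trans (ℕ.+-monoˡ-≤ k i≤j) (ℕ.≰⇒> w≰j+k)))))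
... | yes j≤w | yes w≤j+k with toℕ w ℕ.≤? toℕ i + k
...   | yes w≤i+k = inj₁ (trans (Bk-adj k {j} {w} j≤w w≤j+k)
  (sym (Bk-adj k {i} {w} (ℕ.≤-trans i≤j j≤w) w≤i+k)))
...   | no w≰i+k = inj₂ (trans (Bk-adj k {j} {w} j≤w w≤j+k)
  (sym (Bk-adj k {l} {w}
    (ℕ.≤-trans (row≤ k l) (ℕ.≤-trans (s≤s (ℕ.m≤n+m k (toℕ i))) (ℕ.≰⇒> w≰i+k)))
    (ℕ.≤-trans w≤j+k (ℕ.+-monoˡ-≤ k j≤l)))))

Bk-left-column : ∀ k {v w} → toℕ v ≤ toℕ w → toℕ w ≤ k → NY⊆ (Bk (2 + k)) v w
Bk-left-column k {v} {w} v≤w w≤k i iv =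
  Bk-adj k {i} {w} (ℕ.≤-trans (proj₁ (Bk-adj⁻¹ k {i} {v} iv)) v≤w) (ℕ.≤-trans w≤k (ℕ.m≤n+m k (toℕ i)))

Bk-right-column : ∀ k {v w} → toℕ v ≤ toℕ w → k < toℕ v → NY⊆ (Bk (2 + k)) w v
Bk-right-column k {v} {w} v≤w k<v i iw =
  Bk-adj k {i} {v} (ℕ.≤-trans (row≤ k i) k<v) (ℕ.≤-trans v≤w (proj₂ (Bk-adj⁻¹ k {i} {w} iw)))

-- The columns up to `k` see growing initial segments of rows, the others shrinking final segments:
-- two chains cover Y.
Bk-antichainY≤2 : ∀ k s → AntichainY (Bk (2 + k)) s → s ≤ 2
Bk-antichainY≤2 k s = chain-cover (transpose (Bk (2 + k))) side chain
  where
  side : Fin (n (Bk (2 + k))) → Fin 2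
  side w with toℕ w ℕ.≤? k
  ... | yes _ = 0F
  ... | no _  = 1F

  chain : ∀ v w → side v ≡ side w → NY⊆ (Bk (2 + k)) v w ⊎ NY⊆ (Bk (2 + k)) w v
  chain v w eq with toℕ v ℕ.≤? k | toℕ w ℕ.≤? k | ℕ.≤-total (toℕ v) (toℕ w)
  ... | yes _   | yes w≤k | inj₁ v≤w = inj₁ (Bk-left-column k {v} {w} v≤w w≤k)
  ... | yes v≤k | yes _   | inj₂ w≤v = inj₂ (Bk-left-column k {w} {v} w≤v v≤k)
  ... | no v≰k  | no _    | inj₁ v≤w = inj₂ (Bk-right-column k {v} {w} v≤w (ℕ.≰⇒> v≰k))
  ... | no _    | no w≰k  | inj₂ w≤v = inj₁ (Bk-right-column k {w} {v} w≤v (ℕ.≰⇒> w≰k))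

iso-linear : ∀ k G ((φ , _) : IsoSame G (Bk (2 + k))) {a b c} →
  toℕ (Inverse.to φ a) ≤ toℕ (Inverse.to φ b) → toℕ (Inverse.to φ b) ≤ toℕ (Inverse.to φ c) →
  Between G a b c
iso-linear k G (φ , ψ , eq) {a} {b} {c} a≤b b≤c y =
  Sum.map (λ ba → trans (eq b y) (trans ba (sym (eq a y))))
          (λ bc → trans (eq b y) (trans bc (sym (eq c y))))
          (Bk-linear k {to φ a} {to φ b} {to φ c} a≤b b≤c (to ψ y))
  where open Inverse using (to)

-- Negating all entries preserves betweenness, so one order of X serves both the graph and its
-- mirror.
iso-ACB : ∀ k G → IsoSame G (Bk (2 + k)) → ACB G
iso-ACB k G iso@(φ , _) =
  linear⇒chordal G pos (iso-linear k G iso) ,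
  linear⇒chordal (mir G) pos (λ a≤b b≤c y → Sum.map (cong not) (cong not) (iso-linear k G iso a≤b b≤c y))
  where
  pos : Fin (m G) → ℕ
  pos = toℕ ∘ Inverse.to φ

iso-antichainX : ∀ k G → IsoSame G (Bk (2 + k)) → AntichainX G (2 + k)
iso-antichainX k G (φ , ψ , eq) =
  subgraph-antichain G (Bk (2 + k)) (from φ) (from ψ)
    (λ i w → sym (trans (eq _ _) (cong₂ (E (Bk (2 + k))) (strictlyInverseˡ φ i) (strictlyInverseˡ ψ w))))
    (Incomparable⇒Antichain (Bk (2 + k)) id λ i j → Bk-Diff k)
  where open Inverse using (from; strictlyInverseˡ)

iso-antichainY≤2 : ∀ k G → IsoSame G (Bk (2 + k)) → ∀ s → AntichainY G s → s ≤ 2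
iso-antichainY≤2 k G (φ , ψ , eq) s a = Bk-antichainY≤2 k s
  (subgraph-antichain (transpose (Bk (2 + k))) (transpose G) (Inverse.to ψ) (Inverse.to φ)
    (λ y x → eq x y) a)

maximal⇒BipDilw : ∀ G {a} → NablaX G a → (∃ λ b → NablaX (transpose G) b × b ≤ a) → BipDilw G a
maximal⇒BipDilw G {a} nablaX (b , nablaY , b≤a) =
  a , b , nablaX , nablaY , sym (ℕ.m≥n⇒m⊔n≡m b≤a)

iso-BipDilw : ∀ k G → IsoSame G (Bk (2 + k)) → BipDilw G (2 + k)
iso-BipDilw k G iso@(φ , _) = maximal⇒BipDilw G
  (iso-antichainX k G iso , λ s a → subst (s ≤_) (Perm.↔⇒≡ φ) (size-bound G a))
  (bounded⇒NablaX (transpose G) (2 + k)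
    λ s a → ℕ.≤-trans (iso-antichainY≤2 k G iso s a) (ℕ.m≤m+n 2 k))

iso-delX : ∀ k G → IsoSame G (Bk (2 + k)) → ∀ x → Σ ℕ λ d → BipDilw (delX G x) d × d ≤ suc k
iso-delX k G@(bgraph (suc m) n e) iso x = bounded⇒BipDilw (delX G x) (suc k)
  (λ s a → subst (s ≤_) m≡1+k (size-bound (delX G x) a))
  (boundY k iso m≡1+k)
  where
  m≡1+k : m ≡ suc k
  m≡1+k = ℕ.suc-injective (Perm.↔⇒≡ (proj₁ iso))

  boundY : ∀ k → IsoSame G (Bk (2 + k)) → m ≡ suc k → ∀ s → AntichainY (delX G x) s → s ≤ suc k
  boundY (suc k) iso _ s a = ℕ.≤-trans
    (iso-antichainY≤2 (suc k) G iso s (delY-antichain⁻¹ (transpose G) x a)) (s≤s (s≤s z≤n))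
  -- For B₂ the bound 2 is too weak, but only one vertex of X is left and any two neighbourhoods
  -- inside it are nested.
  boundY zero _ refl s = chain-cover (transpose (delX G x)) {r = 1} (λ _ → 0F) chain
    where
    chain : ∀ y z → 0F ≡ 0F → NY⊆ (delX G x) y z ⊎ NY⊆ (delX G x) z y
    chain y z _ with E (delX G x) 0F z in 0z
    ... | true  = inj₁ λ { 0F _ → 0z }
    ... | false = inj₂ λ { 0F 0z′ → contradiction (trans (sym 0z) 0z′) λ () }

iso-delY : ∀ k G → IsoSame G (Bk (2 + k)) → ∀ y → Σ ℕ λ d → BipDilw (delY G y) d × d ≤ suc k
iso-delY k G@(bgraph (suc m) (suc n) e) iso@(φ , ψ , eq) y
  = bounded⇒BipDilw (delY G y) (suc k) boundX (boundY k iso)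
  where
  open Inverse using (to; from; strictlyInverseˡ; strictlyInverseʳ)

  boundX : ∀ s → AntichainX (delY G y) s → s ≤ suc k
  boundX s a with Bk-column-critical k (to ψ y)
  -- Without `y` two rows become comparable, so an antichain cannot use all of X.
  ... | i , j , i≢j , i⊆j = subst (s ≤_) (ℕ.suc-injective (Perm.↔⇒≡ φ))
    (comparable-pair (E (delY G y)) {from φ i} {from φ j} from-≢ from-⊆ a)
    where
    from-≢ : from φ i ≢ from φ j
    from-≢ p = i≢j (trans (sym (strictlyInverseˡ φ i)) (trans (cong (to φ) p) (strictlyInverseˡ φ j)))

    E-from : ∀ l v → e (from φ l) v ≡ E (Bk (2 + k)) l (to ψ v)
    E-from l v = trans (eq _ v) (cong (λ t → E (Bk (2 + k)) t (to ψ v)) (strictlyInverseˡ φ l))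

    from-⊆ : NX⊆ (delY G y) (from φ i) (from φ j)
    from-⊆ v iv = trans (E-from j v′) (i⊆j (to ψ v′)
      (λ p → Fin.punchInᵢ≢i y v
        (trans (sym (strictlyInverseʳ ψ _)) (trans (cong (from ψ) p) (strictlyInverseʳ ψ y))))
      (trans (sym (E-from i v′)) iv))
      where v′ = punchIn y v

  boundY : ∀ k → IsoSame G (Bk (2 + k)) → ∀ s → AntichainY (delY G y) s → s ≤ suc k
  -- B₂ has two columns, so a single one remains.
  boundY zero (_ , ψ , _) s a =
    subst (s ≤_) (ℕ.suc-injective (Perm.↔⇒≡ ψ)) (size-bound (transpose (delY G y)) a)
  boundY (suc k) iso s a = ℕ.≤-trans
    (iso-antichainY≤2 (suc k) G iso s (delX-antichain⁻¹ (transpose G) y a)) (s≤s (s≤s z≤n))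
iso-delY k (bgraph zero n e) (φ , _) y = contradiction (Perm.↔⇒≡ φ) λ ()

Bk⇒critical : ∀ k G → IsoSame G (Bk (2 + k)) → KCriticalACB (2 + k) G
Bk⇒critical k G iso = iso-ACB k G iso , iso-BipDilw k G iso , iso-delX k G iso , iso-delY k G iso

-- Exchanging the colour classes of a critical graph, and the equivalence

transpose-BipDilw : ∀ G {d} → BipDilw G d → BipDilw (transpose G) d
transpose-BipDilw G (a , b , nablaX , nablaY , d≡) = b , a , nablaY , nablaX , trans d≡ (ℕ.⊔-comm a b)

delX-transpose : ∀ G y {d} → BipDilw (delY G y) d → BipDilw (delX (transpose G) y) d
delX-transpose G@(bgraph m (suc n) e) y = transpose-BipDilw (delY G y)

delY-transpose : ∀ G x {d} → BipDilw (delX G x) d → BipDilw (delY (transpose G) x) d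
delY-transpose G@(bgraph (suc m) n e) x = transpose-BipDilw (delX G x)

transpose-critical : ∀ {k} G → KCriticalACB k G → KCriticalACB k (transpose G)
transpose-critical G (acb , dilw , critX , critY) =
  transpose-ACB G acb , transpose-BipDilw G dilw ,
  (λ y → Prod.map₂ (Prod.map₁ (delX-transpose G y)) (critY y)) ,
  (λ x → Prod.map₂ (Prod.map₁ (delY-transpose G x)) (critX x))

transpose-iso : ∀ G H → IsoSame (transpose G) H → IsoSwap G H
transpose-iso G H (φ , ψ , eq) = ψ , φ , λ x y → eq y x

theorem4 : (k : ℕ) → 2 ≤ k → (G : BGraph) → KCriticalACB k G ⇔ (G ≅ Bk k)
theorem4 (suc (suc k)) (s≤s (s≤s z≤n)) G = mk⇔ to from
  where
  to : KCriticalACB (2 + k) G → G ≅ Bk (2 + k)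
  -- The maximum is attained on one colour class; if that is Y, the transposed graph is recognised
  -- as Bₖ and the isomorphism swaps the classes.
  to crit@(_ , (a , b , (antichainX , _) , (antichainY , _) , k≡a⊔b) , _) with ℕ.⊔-sel a b
  ... | inj₁ a⊔b≡a = inj₁ (critical⇒Bk k G crit
    (subst (AntichainX G) (sym (trans k≡a⊔b a⊔b≡a)) antichainX))
  ... | inj₂ a⊔b≡b = inj₂ (transpose-iso G (Bk (2 + k))
    (critical⇒Bk k (transpose G) (transpose-critical G crit)
      (subst (AntichainY G) (sym (trans k≡a⊔b a⊔b≡b)) antichainY)))

  from : G ≅ Bk (2 + k) → KCriticalACB (2 + k) G
  from (inj₁ iso) = Bk⇒critical k G iso
  from (inj₂ (φ , ψ , eq)) =
    transpose-critical (transpose G) (Bk⇒critical k (transpose G) (ψ , φ , λ y x → eq x y))
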